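{- The sequences $\mathcal{F}^e(F_6)=(F_i^e \bmod F_6 : i\ge 0)$, where $F_6=8$, satisfy: (i) if $e\ge 1$ is an odd integer, then $\pi(F_6,e)=12$; (ii) $\pi(F_6,2)=6$, and if $e\ge 4$ is an even integer, then $\pi(F_6,e)=3$.
   Context: The Fibonacci numbers are $F_0=0$, $F_1=1$, $F_{i+1}=F_i+F_{i-1}$ for $i\ge 1$. For integers $j\ge 1$, $e\ge 1$, $\mathcal{F}^e(F_j)$ denotes the sequence $(F_i^e \bmod F_j : i\ge 0)$ of residues of $F_i^e$ modulo $F_j$. A sequence $(a_i:i\ge 0)$ is periodic if there is an integer $p\ge 1$, called a period, with $a_{i+p}=a_i$ for all $i\ge 0$. The periodicity $\pi(F_j,e)$ is the minimum period of $\mathcal{F}^e(F_j)$. -}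

module Defs where

open import Data.Nat using (ℕ; zero; suc; _+_; _^_; _%_; _≤_; _≥_; NonZero)
open import Data.Product using (_×_)
open import Relation.Binary.PropositionalEquality using (_≡_)

F : ℕ → ℕ
F zero          = 0
F (suc zero)    = 1
F (suc (suc i)) = F (suc i) + F i

-- The sequence 𝓕ᵉ(m), with any nonzero modulus m in place of F j.
𝓕 : (e m : ℕ) .{{_ : NonZero m}} → ℕ → ℕ
𝓕 e m i = (F i ^ e) % m

IsPeriod : (ℕ → ℕ) → ℕ → Set
IsPeriod a p = p ≥ 1 × (∀ i → a (i + p) ≡ a i)

IsMinimumPeriod : (ℕ → ℕ) → ℕ → Set
IsMinimumPeriod a p = IsPeriod a p × (∀ q → IsPeriod a q → p ≤ q)

-- π[ m , e ]≡ p reads "π(m , e) = p". The minimum period is a relation here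
-- because a function π would need a proof that a period always exists; being a
-- minimum, p is unique.
π[_,_]≡_ : (m e : ℕ) .{{_ : NonZero m}} → ℕ → Set
π[ m , e ]≡ p = IsMinimumPeriod (𝓕 e m) p

{-# OPTIONS --safe #-}

-- Modulo 8 the Fibonacci sequence has period 12, and x⁵ ≡ x³ for every x, so
-- x ^ e depends, for e ≥ 3, only on the parity of e. This leaves the exponents
-- 1, 2, 3 and 4; each gives a sequence with period 12, whose minimum period is
-- decided by inspecting finitely many terms.
module Submission where

open import Defs
open import Data.Nat using (ℕ; zero; suc; _+_; _*_; _^_; _%_; _/_; _≤_; _≥_; z≤n; s≤s; NonZero)
open import Data.Nat.DivMod using (%-distribˡ-+; %-distribˡ-*; m%n%n≡m%n; m%n<n; m≡m%n+[m/n]*n)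
open import Data.Nat.Divisibility using (_∣_; _∤_; divides)
open import Data.Nat.Properties using (_≟_; ≮⇒≥; +-assoc; +-comm)
open import Data.Fin using (Fin; toℕ; fromℕ<)
open import Data.Fin.Properties using (all?; toℕ-fromℕ<)
open import Data.Product using (_×_; _,_; proj₁; proj₂; ∃)
open import Relation.Binary.PropositionalEquality
open import Relation.Nullary using (¬_; Dec; contradiction)
open import Relation.Nullary.Decidable using (True; toWitness; ¬?; _×-dec_)

module _ {m : ℕ} .{{_ : NonZero m}} where

  +-cong-% : ∀ a b c d → a % m ≡ b % m → c % m ≡ d % m → (a + c) % m ≡ (b + d) % m
  +-cong-% a b c d p q =
    trans (%-distribˡ-+ a c m)
      (trans (cong₂ (λ x y → (x + y) % m) p q) (sym (%-distribˡ-+ b d m)))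

  *-cong-% : ∀ a b c d → a % m ≡ b % m → c % m ≡ d % m → (a * c) % m ≡ (b * d) % m
  *-cong-% a b c d p q =
    trans (%-distribˡ-* a c m)
      (trans (cong₂ (λ x y → (x * y) % m) p q) (sym (%-distribˡ-* b d m)))

  ^-cong-% : ∀ a b e → a % m ≡ b % m → (a ^ e) % m ≡ (b ^ e) % m
  ^-cong-% a b zero    p = refl
  ^-cong-% a b (suc e) p = *-cong-% a b (a ^ e) (b ^ e) p (^-cong-% a b e p)

  -- The recurrence determines all later residues from two consecutive ones, so agreement at the
  -- first two indices propagates.
  F-%-periodic : ∀ p → F p % m ≡ F 0 % m → F (suc p) % m ≡ F 1 % m →
                 ∀ i → F (i + p) % m ≡ F i % m
  F-%-periodic p p₀ p₁ zero          = p₀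
  F-%-periodic p p₀ p₁ (suc zero)    = p₁
  F-%-periodic p p₀ p₁ (suc (suc i)) =
    +-cong-% (F (suc i + p)) (F (suc i)) (F (i + p)) (F i)
      (F-%-periodic p p₀ p₁ (suc i)) (F-%-periodic p p₀ p₁ i)

-- Indexing by `Fin n` makes the condition decidable; nothing is lost when `n` is itself a period of
-- `a`.
IsPeriodBelow : ℕ → (ℕ → ℕ) → ℕ → Set
IsPeriodBelow n a p = (i : Fin n) → a (toℕ i + p) ≡ a (toℕ i)

isPeriodBelow? : ∀ n a p → Dec (IsPeriodBelow n a p)
isPeriodBelow? n a p = all? (λ i → a (toℕ i + p) ≟ a (toℕ i))

module _ {a : ℕ → ℕ} {n : ℕ} .{{_ : NonZero n}} (a-periodic : ∀ i → a (i + n) ≡ a i) where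

  periodic-* : ∀ k i → a (i + k * n) ≡ a i
  periodic-* zero    i = cong a (+-comm i 0)
  periodic-* (suc k) i =
    trans (cong a (sym (+-assoc i n (k * n))))
      (trans (periodic-* k (i + n)) (a-periodic i))

  periodic-% : ∀ i p → a (i + p) ≡ a (i % n + p)
  periodic-% i p = begin
    a (i + p)                     ≡⟨ cong (λ j → a (j + p)) (m≡m%n+[m/n]*n i n) ⟩
    a (i % n + i / n * n + p)     ≡⟨ cong a (+-assoc (i % n) _ p) ⟩
    a (i % n + (i / n * n + p))   ≡⟨ cong (λ j → a (i % n + j)) (+-comm _ p) ⟩
    a (i % n + (p + i / n * n))   ≡⟨ cong a (sym (+-assoc (i % n) p _)) ⟩
    a (i % n + p + i / n * n)     ≡⟨ periodic-* (i / n) (i % n + p) ⟩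
    a (i % n + p)                 ∎
    where open ≡-Reasoning

  -- Both sides depend only on `i % n`; for `a i` this is `periodic-%` with shift 0.
  below⇒periodic : ∀ {p} → IsPeriodBelow n a p → ∀ i → a (i + p) ≡ a i
  below⇒periodic {p} below i = begin
    a (i + p)      ≡⟨ periodic-% i p ⟩
    a (i % n + p)  ≡⟨ subst (λ j → a (j + p) ≡ a j) (toℕ-fromℕ< i%n<n) (below (fromℕ< i%n<n)) ⟩
    a (i % n)      ≡⟨ cong a (+-comm 0 (i % n)) ⟩
    a (i % n + 0)  ≡⟨ sym (periodic-% i 0) ⟩
    a (i + 0)      ≡⟨ cong a (+-comm i 0) ⟩
    a i            ∎
    where
    open ≡-Reasoning
    i%n<n = m%n<n i n

  -- A period satisfies the bounded condition in particular, so refuting that for each smaller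
  -- candidate suffices. Writing candidates as successors leaves out 0.
  isMinimumPeriod : ∀ p → IsPeriodBelow n a (suc p) →
                    ((q : Fin p) → ¬ IsPeriodBelow n a (suc (toℕ q))) →
                    IsMinimumPeriod a (suc p)
  isMinimumPeriod p below smaller = (s≤s z≤n , below⇒periodic below) , minimal
    where
    minimal : ∀ q → IsPeriod a q → suc p ≤ q
    minimal (suc q) (_ , periodic) = s≤s (≮⇒≥ λ q<p →
      smaller (fromℕ< q<p)
        (subst (λ r → IsPeriodBelow n a (suc r)) (sym (toℕ-fromℕ< q<p))
          (λ i → periodic (toℕ i))))

isMinimumPeriod-resp-≗ : ∀ {a b p} → a ≗ b → IsMinimumPeriod a p → IsMinimumPeriod b p
isMinimumPeriod-resp-≗ a≗b (period , minimal) =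
  transport a≗b period , λ q period′ → minimal q (transport (λ i → sym (a≗b i)) period′)
  where
  transport : ∀ {a b p} → a ≗ b → IsPeriod a p → IsPeriod b p
  transport {p = p} a≗b (p≥1 , periodic) =
    p≥1 , λ i → trans (sym (a≗b (i + p))) (trans (periodic i) (a≗b i))

-- For concrete `e` and `p` the decision evaluates to yes, and the implicit argument is then solved
-- automatically.
π-8-decided : ∀ e p →
  {True (isPeriodBelow? 12 (𝓕 e 8) (suc p)
         ×-dec all? {n = p} (λ q → ¬? (isPeriodBelow? 12 (𝓕 e 8) (suc (toℕ q)))))} →
  π[ 8 , e ]≡ suc p
π-8-decided e p {checked} =
  isMinimumPeriod {n = 12}
    -- The two `refl` hold by evaluation: `F 12` is 144 = 18 * 8 and `F 13` is 233 = 29 * 8 + 1.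
    (λ i → ^-cong-% (F (i + 12)) (F i) e (F-%-periodic 12 refl refl i))
    p (proj₁ (toWitness checked)) (proj₂ (toWitness checked))

-- If `x` is even, 8 divides x³; if `x` is odd, 8 divides x² - 1. The proof simply checks the eight
-- residues.
x⁵≡x³-%8 : ∀ x → (x ^ 5) % 8 ≡ (x ^ 3) % 8
x⁵≡x³-%8 x = begin
  (x ^ 5) % 8        ≡⟨ ^-cong-% x (x % 8) 5 (sym (m%n%n≡m%n x 8)) ⟩
  ((x % 8) ^ 5) % 8  ≡⟨ subst (λ y → (y ^ 5) % 8 ≡ (y ^ 3) % 8) (toℕ-fromℕ< x%8<8) (residues (fromℕ< x%8<8)) ⟩
  ((x % 8) ^ 3) % 8  ≡⟨ ^-cong-% (x % 8) x 3 (m%n%n≡m%n x 8) ⟩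
  (x ^ 3) % 8        ∎
  where
  open ≡-Reasoning
  x%8<8 = m%n<n x 8
  residues : (y : Fin 8) → (toℕ y ^ 5) % 8 ≡ (toℕ y ^ 3) % 8
  residues = toWitness {a? = all? (λ y → (toℕ y ^ 5) % 8 ≟ (toℕ y ^ 3) % 8)} _

^-+2-%8 : ∀ x r → (x ^ (5 + r)) % 8 ≡ (x ^ (3 + r)) % 8
^-+2-%8 x zero    = x⁵≡x³-%8 x
^-+2-%8 x (suc r) = *-cong-% x x (x ^ (5 + r)) (x ^ (3 + r)) refl (^-+2-%8 x r)

-- Here `r` selects the parity: 0 reduces odd exponents to 3, and 1 reduces even exponents to 4.
^-+even-%8 : ∀ x r k → (x ^ (3 + (r + k * 2))) % 8 ≡ (x ^ (3 + r)) % 8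
^-+even-%8 x zero    zero    = refl
^-+even-%8 x zero    (suc k) = trans (^-+2-%8 x (k * 2)) (^-+even-%8 x zero k)
^-+even-%8 x (suc r) k       =
  *-cong-% x x (x ^ (3 + (r + k * 2))) (x ^ (3 + r)) refl (^-+even-%8 x r k)

odd⇒1+k*2 : ∀ e → 2 ∤ e → ∃ λ k → e ≡ 1 + k * 2
odd⇒1+k*2 e 2∤e with e % 2 | m%n<n e 2 | m≡m%n+[m/n]*n e 2
... | 0           | _              | e≡ = contradiction (divides (e / 2) e≡) 2∤e
... | 1           | _              | e≡ = e / 2 , e≡
... | suc (suc _) | s≤s (s≤s ())   | _

π-8-odd : ∀ k → π[ 8 , 1 + k * 2 ]≡ 12
-- Exponent 1 cannot be merged with 3: 2 and 2³ differ modulo 8.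
π-8-odd zero    = π-8-decided 1 11
π-8-odd (suc k) =
  isMinimumPeriod-resp-≗ (λ i → sym (^-+even-%8 (F i) 0 k)) (π-8-decided 3 11)

-- Modulo 8 a fourth power is 0 or 1 according to parity, and `F i` is even exactly when 3 divides
-- `i`; hence the residues 0, 1, 1 repeat.
π-8-even : ∀ k → π[ 8 , 4 + k * 2 ]≡ 3
π-8-even k =
  isMinimumPeriod-resp-≗ (λ i → sym (^-+even-%8 (F i) 1 k)) (π-8-decided 4 2)

proposition4 : (∀ (e : ℕ) → e ≥ 1 → 2 ∤ e → π[ F 6 , e ]≡ 12)
    × (π[ F 6 , 2 ]≡ 6)
    × (∀ (e : ℕ) → e ≥ 4 → 2 ∣ e → π[ F 6 , e ]≡ 3)
proposition4 = odd , π-8-decided 2 5 , even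
  where
  odd : ∀ e → e ≥ 1 → 2 ∤ e → π[ F 6 , e ]≡ 12
  odd e _ 2∤e with odd⇒1+k*2 e 2∤e
  ... | k , refl = π-8-odd k

  even : ∀ e → e ≥ 4 → 2 ∣ e → π[ F 6 , e ]≡ 3
  even _ ()                          (divides 0 refl)
  even _ (s≤s (s≤s ()))              (divides 1 refl)
  -- The product `suc (suc k) * 2` reduces to `4 + k * 2`, and `F 6` to 8.
  even _ _                           (divides (suc (suc k)) refl) = π-8-even k
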